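{- Let $a>1$ be an integer, and define the sequence $(u_i)_{i\geq 0}$ by $u_0=0$, $u_1=1$, and $u_{i+1}=au_i+u_{i-1}$ for $i=1,2,3,\ldots$. Then no integer $x$ can be written as $x=u_m+au_n$ with $m\in\{0,1,2,\ldots\}$ and $n\in\{1,2,3,\ldots\}$ in two or more different ways (i.e., for two distinct pairs $(m,n)$), except in the case $a=2$ and $x=4=u_0+au_2=u_2+au_1$. -}

module Defs where

open import Data.Integer using (ℤ; 0ℤ; 1ℤ; _+_; _*_)
open import Data.Nat as ℕ using (ℕ; zero; suc)
open import Data.Product using (_×_; _,_; ∃₂)
open import Relation.Binary.PropositionalEquality using (_≡_; _≢_)

u : ℤ → ℕ → ℤ
u a zero          = 0ℤ
u a (suc zero)    = 1ℤ
u a (suc (suc i)) = a * u a (suc i) + u a i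

-- The pair (m , n) is a way of writing x.  The index m may be 0, but n may not.
IsWay : ℤ → ℤ → ℕ × ℕ → Set
IsWay a x (m , n) = 1 ℕ.≤ n × x ≡ u a m + a * u a n

-- Ways are counted as ordered pairs of indices: p and q need only differ in
-- one coordinate.
TwoWays : ℤ → ℤ → Set
TwoWays a x = ∃₂ λ (p q : ℕ × ℕ) → p ≢ q × IsWay a x p × IsWay a x q

-- Suppose u_m + a u_n = u_k + a u_l with n < l.  Then k < m, and since
-- u_{i+1} - u_i ≡ ±1 (mod a) even k + 2 ≤ m.  If l < m, then
-- u_m + a u_n > u_{m-2} + a u_{m-1} ≥ u_k + a u_l, so m ≤ l.  But then
-- u_m + a u_n ≤ u_l + a u_{l-1} = 2 u_l - u_{l-2}, whence
-- (a - 2) u_l + u_k + u_{l-2} ≤ 0, which forces a = 2, k = 0 and l = 2.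
module Submission where

open import Defs
open import Data.Integer as ℤ using (ℤ; +_; 1ℤ; _<_)
import Data.Integer.Properties as ℤ
open import Data.Nat as ℕ using (ℕ; zero; suc; _+_; _*_; _≤_; z≤n; s≤s)
open import Data.Nat.Divisibility using (_∣_; ∣1⇒≡1; ∣m+n∣m⇒∣n; m∣m*n; ∣-reflexive; ∣-trans)
open import Data.Nat.Properties
open import Data.Nat.Tactic.RingSolver using (solve-∀)
open import Data.Product using (_×_; _,_)
open import Relation.Binary.Definitions using (tri<; tri≈; tri>)
open import Relation.Binary.PropositionalEquality
open import Relation.Nullary using (¬_; contradiction)

-- A copy of `u` over the naturals, where all terms live once `a > 1`. Order, divisibility and
-- cancellation are handled there, and `u≡+uℕ` carries equations across.
uℕ : ℕ → ℕ → ℕ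
uℕ a zero          = 0
uℕ a (suc zero)    = 1
uℕ a (suc (suc i)) = a * uℕ a (suc i) + uℕ a i

u≡+uℕ : ∀ a i → u (+ a) i ≡ + uℕ a i
u≡+uℕ a zero          = refl
u≡+uℕ a (suc zero)    = refl
u≡+uℕ a (suc (suc i))
  rewrite u≡+uℕ a (suc i) | u≡+uℕ a i | sym (ℤ.pos-* a (uℕ a (suc i))) = refl

u+a*u≡ : ∀ a m n → u (+ a) m ℤ.+ (+ a) ℤ.* u (+ a) n ≡ + (uℕ a m + a * uℕ a n)
u+a*u≡ a m n rewrite u≡+uℕ a m | u≡+uℕ a n | sym (ℤ.pos-* a (uℕ a n)) = refl

module _ (b : ℕ) where

  private
    -- The form `2 + b` builds in `a > 1` and makes `b` the coefficient `a - 2` of the final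
    -- inequality.
    a : ℕ
    a = 2 + b

    v : ℕ → ℕ
    v = uℕ a

  v[i]<v[1+i] : ∀ i → v i ℕ.< v (suc i)
  v[i]<v[1+i] zero    = s≤s z≤n
  v[i]<v[1+i] (suc i) = begin-strict
    v (suc i)                   <⟨ m<m+n (v (suc i)) (≤-<-trans z≤n (v[i]<v[1+i] i)) ⟩
    v (suc i) + v (suc i)       ≤⟨ +-monoʳ-≤ (v (suc i)) (m≤m+n _ (b * v (suc i))) ⟩
    a * v (suc i)               ≤⟨ m≤m+n _ (v i) ⟩
    a * v (suc i) + v i         ∎
    where open ≤-Reasoning

  v-mono-≤ : ∀ {i j} → i ≤ j → v i ≤ v j
  v-mono-≤ i≤j = go (≤⇒≤′ i≤j)
    where
    go : ∀ {i j} → i ℕ.≤′ j → v i ≤ v j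
    go ℕ.≤′-refl               = ≤-refl
    go (ℕ.≤′-step {n = j} i≤j) = ≤-trans (go i≤j) (<⇒≤ (v[i]<v[1+i] j))

  v-mono-< : ∀ {i j} → i ℕ.< j → v i ℕ.< v j
  v-mono-< {i} i<j = <-≤-trans (v[i]<v[1+i] i) (v-mono-≤ i<j)

  v-cancel-< : ∀ {i j} → v i ℕ.< v j → i ℕ.< j
  v-cancel-< vi<vj = ≰⇒> λ j≤i → <⇒≱ vi<vj (v-mono-≤ j≤i)

  v-injective : ∀ {i j} → v i ≡ v j → i ≡ j
  v-injective {i} {j} eq with <-cmp i j
  ... | tri< i<j _ _ = contradiction eq (<⇒≢ (v-mono-< i<j))
  ... | tri≈ _ i≡j _ = i≡j
  ... | tri> _ _ j<i = contradiction (sym eq) (<⇒≢ (v-mono-< j<i))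

  v≡0⇒≡0 : ∀ {i} → v i ≡ 0 → i ≡ 0
  v≡0⇒≡0 = v-injective

  -- Multiples of `a` on both sides express incongruence modulo `a` without subtraction. The
  -- recurrence gives `v (2 + i) ≡ v i` modulo `a`, so a congruence of neighbours descends, with
  -- sides swapped, to `1 ≡ 0`.
  v[1+i]≢v[i]-mod-a : ∀ i s t → v (suc i) + a * s ≢ v i + a * t
  v[1+i]≢v[i]-mod-a zero s t eq = contradiction (∣1⇒≡1 a∣1) λ ()
    where
    a∣1 : a ∣ 1
    a∣1 = ∣m+n∣m⇒∣n
      (∣-trans (m∣m*n t) (∣-reflexive (trans (sym eq) (+-comm 1 (a * s)))))
      (m∣m*n s)
  v[1+i]≢v[i]-mod-a (suc i) s t eq =
    v[1+i]≢v[i]-mod-a i t (v (suc i) + s)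
      (trans (sym eq) (regroup a (v (suc i)) (v i) s))
    where
    regroup : ∀ a p q s → a * p + q + a * s ≡ q + a * (p + s)
    regroup = solve-∀

  two-ways⇒k≡0,b≡0,l≡2 : ∀ {m n k l} → 1 ≤ n → n ℕ.< l →
    v m + a * v n ≡ v k + a * v l → k ≡ 0 × b ≡ 0 × l ≡ 2
  two-ways⇒k≡0,b≡0,l≡2 {l = suc zero} (s≤s _) (s≤s ())
  -- As `1 ≤ n < l`, the larger index is at least 2; from here on `l` denotes that index less two.
  two-ways⇒k≡0,b≡0,l≡2 {m} {n} {k} {suc (suc l)} 1≤n n<l eq = k≡0 , b≡0 , cong (λ i → 2 + i) l≡0
    where
    open ≤-Reasoning

    L : ℕ
    L = v (2 + l)

    k<m : k ℕ.< m
    k<m = v-cancel-< (+-cancelʳ-< (a * L) (v k) (v m) (begin-strict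
      v k + a * L    ≡⟨ eq ⟨
      v m + a * v n  <⟨ +-monoʳ-< (v m) (*-monoʳ-< a (v-mono-< n<l)) ⟩
      v m + a * L    ∎))

    2+k≤m : 2 + k ≤ m
    -- If `m` were `1 + k`, then `eq` would make neighbouring terms congruent modulo `a`.
    2+k≤m = ≤∧≢⇒< k<m λ { refl → v[1+i]≢v[i]-mod-a k (v n) L eq }

    -- Both right-hand indices would be so small that the recurrence bounds that side by the first
    -- term on the left alone, while `a * v n` is positive. The facts about `m` are arguments so
    -- that `m` can be split as `2 + m`.
    l≮ : ∀ m → v m + a * v n ≡ v k + a * L → 2 + k ≤ m → ¬ (2 + l ℕ.< m)
    l≮ (suc (suc m)) eq (s≤s (s≤s k≤m)) (s≤s l≤m) = <-irrefl (sym eq) (begin-strict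
      v k + a * L              ≤⟨ +-mono-≤ (v-mono-≤ k≤m) (*-monoʳ-≤ a (v-mono-≤ l≤m)) ⟩
      v m + a * v (suc m)      ≡⟨ +-comm (v m) _ ⟩
      v (2 + m)                <⟨ m<m+n _ (≤-<-trans z≤n (*-monoʳ-< a (v-mono-< 1≤n))) ⟩
      v (2 + m) + a * v n      ∎)

    m≤l : m ≤ 2 + l
    m≤l = ≮⇒≥ (l≮ m eq 2+k≤m)

    -- Adding `v l` to both sides of `eq` completes `a * v (suc l)` to `L`, so the left side is at
    -- most `2 * L`, which then cancels.
    sum≡0 : v k + v l + b * L ≡ 0
    sum≡0 = n≤0⇒n≡0 (+-cancelʳ-≤ (2 * L) _ 0 (begin
      v k + v l + b * L + 2 * L    ≡⟨ regroup (v k) (v l) b L ⟩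
      v k + a * L + v l            ≡⟨ cong (λ z → z + v l) eq ⟨
      v m + a * v n + v l          ≤⟨ +-monoˡ-≤ (v l) (+-mono-≤ (v-mono-≤ m≤l) (*-monoʳ-≤ a (v-mono-≤ (ℕ.s≤s⁻¹ n<l)))) ⟩
      L + a * v (suc l) + v l      ≡⟨ +-assoc L _ _ ⟩
      L + L                        ≡⟨ cong (λ z → L + z) (+-identityʳ L) ⟨
      2 * L                        ∎))
      where
      regroup : ∀ p q b r → p + q + b * r + 2 * r ≡ p + (2 + b) * r + q
      regroup = solve-∀

    vk+vl≡0 : v k + v l ≡ 0
    vk+vl≡0 = m+n≡0⇒m≡0 _ sum≡0

    k≡0 : k ≡ 0
    k≡0 = v≡0⇒≡0 (m+n≡0⇒m≡0 _ vk+vl≡0)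

    l≡0 : l ≡ 0
    l≡0 = v≡0⇒≡0 (m+n≡0⇒n≡0 (v k) vk+vl≡0)

    b≡0 : b ≡ 0
    -- `L` is positive, so the vanishing of `b * L` falls on `b`.
    b≡0 = m*n≡0⇒m≡0 b L ⦃ ℕ.>-nonZero (v-mono-< {0} {2 + l} (s≤s z≤n)) ⦄
      (m+n≡0⇒n≡0 (v k + v l) sum≡0)

a≡2∧x≡4 : ∀ b {x m n k l} → 1 ≤ n → n ℕ.< l →
  IsWay (+ (2 + b)) x (m , n) → IsWay (+ (2 + b)) x (k , l) →
  + (2 + b) ≡ + 2 × x ≡ + 4
a≡2∧x≡4 b {m = m} {n} {k} {l} 1≤n n<l (_ , x≡₁) (_ , x≡₂)
  with two-ways⇒k≡0,b≡0,l≡2 b {m} {n} {k} {l} 1≤n n<l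
         (ℤ.+-injective (trans (sym (u+a*u≡ (2 + b) m n))
           (trans (trans (sym x≡₁) x≡₂) (u+a*u≡ (2 + b) k l))))
-- With all three values substituted, the right side of `x≡₂` computes to 4.
... | refl , refl , refl = refl , x≡₂

theorem1p2 : (∀ (a : ℤ) → 1ℤ < a → ∀ (x : ℤ) → TwoWays a x → a ≡ + 2 × x ≡ + 4)
    × IsWay (+ 2) (+ 4) (0 , 2) × IsWay (+ 2) (+ 4) (2 , 1)
theorem1p2 = unique , (s≤s z≤n , refl) , (s≤s z≤n , refl)
  where
  unique : ∀ (a : ℤ) → 1ℤ < a → ∀ (x : ℤ) → TwoWays a x → a ≡ + 2 × x ≡ + 4
  unique (+ suc (suc b)) _ x ((m , n) , (k , l) , p≢q , p@(1≤n , x≡₁) , q@(1≤l , x≡₂))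
    with <-cmp n l
  ... | tri< n<l _ _ = a≡2∧x≡4 b {m = m} {k = k} 1≤n n<l p q
  ... | tri> _ _ l<n = a≡2∧x≡4 b {m = k} {k = m} 1≤l l<n q p
  -- With equal second indices the terms `a * v n` cancel, and injectivity of `v` identifies the
  -- pairs.
  ... | tri≈ _ refl _ = contradiction (cong (_, n) m≡k) p≢q
    where
    m≡k : m ≡ k
    m≡k = v-injective b (+-cancelʳ-≡ _ _ _
      (ℤ.+-injective (trans (sym (u+a*u≡ (2 + b) m n))
        (trans (trans (sym x≡₁) x≡₂) (u+a*u≡ (2 + b) k n)))))
  unique (+ suc zero) (ℤ.+<+ (s≤s ()))
  unique (+ zero)     (ℤ.+<+ ())
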